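{- Let $M$ be a finite simple graph on $p$ vertices and let $\Delta$ be the maximum vertex degree of $M$. Then the path energy of $M$ satisfies $PE(M) \leq p(p-1)\Delta$.
   Context: For a finite simple graph $M$ with vertex set $\{v_1,\dots,v_p\}$, the path matrix $P(M)=(p_{i,j})$ is the $p\times p$ real symmetric matrix with $p_{i,i}=0$ and, for $i\neq j$, $p_{i,j}$ equal to the maximum number of vertex disjoint paths from $v_i$ to $v_j$ (i.e. paths that pairwise share no vertices other than the endpoints $v_i,v_j$; an edge $v_iv_j$ counts as one such path). The path eigenvalues of $M$ are the eigenvalues of $P(M)$, and the path energy $PE(M)$ is the sum of the absolute values of the path eigenvalues, counted with multiplicity. -}

module Defs where

open import Level using (0ℓ)
open import Algebra.Bundles using (RawRing)
import Algebra.Definitions.RawSemiring as RawSemiringDefs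
open import Data.Bool.Base using (if_then_else_)
open import Data.Fin.Base using (Fin; zero; suc; toℕ; punchIn)
import Data.Fin.Properties as Fin
import Data.Integer.Base as ℤ
open import Data.List.Base using (List; []; _∷_; [_]; _++_; length; map; filter; allFin; lookup)
import Data.List.Properties as List
open import Data.List.Extrema.Nat using (max)
open import Data.List.Membership.Propositional using (_∉_)
open import Data.List.Membership.Propositional.Properties using (∈-++⁺ʳ; ∈-lookup)
open import Data.List.Relation.Binary.Disjoint.Propositional using (Disjoint)
import Data.List.Relation.Binary.Disjoint.DecPropositional as DecDisjoint
open import Data.List.Relation.Unary.All as All using (All; []; _∷_; all?)
open import Data.List.Relation.Unary.All.Properties using (All¬⇒¬Any)
import Data.List.Relation.Unary.All.Properties as All
open import Data.List.Relation.Unary.AllPairs using (AllPairs; []; _∷_; allPairs?)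
import Data.List.Relation.Unary.AllPairs.Properties as AllPairs
open import Data.List.Relation.Unary.Any using (here; there)
open import Data.List.Relation.Unary.Linked using (Linked; linked?)
open import Data.List.Relation.Unary.Unique.Propositional using (Unique)
open import Data.Nat.Base as ℕ using (ℕ; zero; suc; z≤n; s≤s)
import Data.Nat.Properties as ℕ
open import Data.Product.Base using (∃; _×_; _,_; proj₁; proj₂)
open import Data.Rational.Base as ℚ using (ℚ; 0ℚ; 1ℚ; ½)
import Data.Rational.Properties as ℚ
open import Data.Rational.Solver using (module +-*-Solver)
open import Data.Sum.Base using (inj₁; inj₂)
open import Data.Vec.Functional using (Vector)
open import Function.Base using (_∘_)
open import Function.Definitions using (Injective)
open import Relation.Binary.Core using (Rel)
open import Relation.Binary.Definitions using (Decidable; Symmetric; Irreflexive)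
open import Relation.Binary.PropositionalEquality
  using (_≡_; _≢_; refl; sym; trans; cong; cong₂; subst)
open import Relation.Nullary using (¬_; Dec; yes; no; does; contradiction; ¬?; map′; _×-dec_)
import Relation.Unary as U

------------------------------------------------------------------------
-- Graphs

record Graph (p : ℕ) : Set₁ where
  field
    Adj    : Rel (Fin p) 0ℓ
    adj?   : Decidable Adj
    symm   : Symmetric Adj
    irrefl : Irreflexive _≡_ Adj

module _ {p : ℕ} (M : Graph p) where
  open Graph M

  degree : Fin p → ℕ
  degree v = length (filter (adj? v) (allFin p))

  maxDegree : ℕ
  maxDegree = max 0 (map degree (allFin p))

  -- A path from u to v is represented by the list ws of its interior
  -- vertices; ws = [] is the path consisting of the edge uv alone.
  record IsPath (u v : Fin p) (ws : List (Fin p)) : Set where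
    constructor mkIsPath
    field
      unique : Unique (u ∷ ws ++ [ v ])
      linked : Linked Adj (u ∷ ws ++ [ v ])

  -- Distinctness has to be required separately: an edge path has no
  -- interior, so it is disjoint from a second copy of itself.
  record VertexDisjointPaths (u v : Fin p) (wss : List (List (Fin p))) : Set where
    constructor mkVertexDisjointPaths
    field
      paths    : All (IsPath u v) wss
      distinct : Unique wss
      disjoint : AllPairs Disjoint wss

  record IsMaxDisjointPaths (u v : Fin p) (k : ℕ) : Set where
    constructor mkIsMaxDisjointPaths
    field
      attained : ∃ λ wss → length wss ≡ k × VertexDisjointPaths u v wss
      maximal  : ∀ wss → VertexDisjointPaths u v wss → length wss ℕ.≤ k

------------------------------------------------------------------------
-- Existence of the maximum number of vertex disjoint paths, by
-- exhaustive search

-- A finite search over elements satisfying Q gives one over lists of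
-- fixed length all of whose elements satisfy Q.
∃-ofLength? : {A : Set} {Q : U.Pred A 0ℓ} →
              (∀ {P : U.Pred A 0ℓ} → U.Decidable P → Dec (∃ λ a → Q a × P a)) →
              ∀ n {P : U.Pred (List A) 0ℓ} → U.Decidable P →
              Dec (∃ λ as → length as ≡ n × All Q as × P as)
∃-ofLength? search zero P? =
  map′ (λ P[] → [] , refl , [] , P[]) (λ { ([] , _ , _ , P[]) → P[] }) (P? [])
∃-ofLength? search (suc n) P? =
  map′ (λ { (a , Qa , as , refl , Qas , Pas) → a ∷ as , refl , Qa ∷ Qas , Pas })
       (λ { (a ∷ as , refl , Qa ∷ Qas , Pas) → a , Qa , as , refl , Qas , Pas })
       (search λ a → ∃-ofLength? search n (λ as → P? (a ∷ as)))

∃-≤? : {P : U.Pred ℕ 0ℓ} → U.Decidable P → ∀ b → Dec (∃ λ n → n ℕ.≤ b × P n)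
∃-≤? P? b = map′ (λ { (n , s≤s n≤b , Pn) → n , n≤b , Pn })
                 (λ { (n , n≤b , Pn) → n , s≤s n≤b , Pn })
                 (ℕ.anyUpTo? P? (suc b))

greatest : {P : U.Pred ℕ 0ℓ} → U.Decidable P → P 0 → ∀ b → (∀ n → P n → n ℕ.≤ b) →
           ∃ λ m → P m × (∀ n → P n → n ℕ.≤ m)
greatest P? P0 zero    ub = 0 , P0 , ub
greatest P? P0 (suc b) ub with P? (suc b)
... | yes Pb = suc b , Pb , ub
... | no ¬Pb = greatest P? P0 b λ n Pn →
  ℕ.≤-pred (ℕ.≤∧≢⇒< (ub n Pn) λ { refl → ¬Pb Pn })

lookup-injective : {A : Set} {xs : List A} → Unique xs → Injective _≡_ _≡_ (lookup xs)
lookup-injective (_    ∷ _)  {zero}  {zero}  _  = refl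
lookup-injective (x∉xs ∷ _)  {zero}  {suc j} eq = contradiction eq (All.lookup x∉xs (∈-lookup j))
lookup-injective (x∉xs ∷ _)  {suc i} {zero}  eq = contradiction (sym eq) (All.lookup x∉xs (∈-lookup i))
lookup-injective (_    ∷ u)  {suc i} {suc j} eq = cong suc (lookup-injective u eq)

unique⇒length≤ : ∀ {p} {xs : List (Fin p)} → Unique xs → length xs ℕ.≤ p
unique⇒length≤ u = Fin.injective⇒≤ (lookup-injective u)

module _ {p : ℕ} (M : Graph p) (u v : Fin p) where
  open Graph M

  isPath? : U.Decidable (IsPath M u v)
  isPath? ws = map′ (λ (a , b) → mkIsPath a b) (λ (mkIsPath a b) → a , b)
    (allPairs? (λ x y → ¬? (x Fin.≟ y)) _ ×-dec linked? adj? _)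

  vertexDisjointPaths? : U.Decidable (VertexDisjointPaths M u v)
  vertexDisjointPaths? wss =
    map′ (λ (a , b , c) → mkVertexDisjointPaths a b c)
         (λ (mkVertexDisjointPaths a b c) → a , b , c)
    (all? isPath? wss ×-dec
     allPairs? (λ x y → ¬? (List.≡-dec Fin._≟_ x y)) wss ×-dec
     allPairs? (DecDisjoint.disjoint? Fin._≟_) wss)

  unique-init : ∀ ws → Unique (ws ++ [ v ]) → Unique ws × v ∉ ws
  unique-init []       _         = [] , λ ()
  unique-init (w ∷ ws) (w∉ ∷ un) with unique-init ws un
  ... | un′ , v∉ = All.++⁻ˡ ws w∉ ∷ un′ ,
    λ { (here refl) → All¬⇒¬Any w∉ (∈-++⁺ʳ ws (here refl)) ; (there v∈) → v∉ v∈ }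

  path-interior : ∀ {ws} → IsPath M u v ws → Unique ws × v ∉ ws
  path-interior {ws} (mkIsPath (_ ∷ un) _) = unique-init ws un

  ∃path? : ∀ {P : U.Pred (List (Fin p)) 0ℓ} → U.Decidable P →
           Dec (∃ λ ws → IsPath M u v ws × P ws)
  ∃path? P? =
    map′ (λ { (_ , _ , ws , _ , _ , path , Pws) → ws , path , Pws })
         (λ { (ws , path , Pws) →
              length ws , unique⇒length≤ (proj₁ (path-interior path)) ,
              ws , refl , All.universal (λ _ → refl) ws , path , Pws })
         (∃-≤? (λ n → ∃-ofLength? {Q = λ x → x ≡ x} ∃vertex? n
                        (λ ws → isPath? ws ×-dec P? ws)) p)
    where
    ∃vertex? : ∀ {P : U.Pred (Fin p) 0ℓ} → U.Decidable P → Dec (∃ λ x → x ≡ x × P x)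
    ∃vertex? P? = Fin.any? (λ x → yes refl ×-dec P? x)

  ∃disjointPaths? : ∀ k → Dec (∃ λ wss → length wss ≡ k × VertexDisjointPaths M u v wss)
  ∃disjointPaths? k =
    map′ (λ { (wss , len , _ , vd) → wss , len , vd })
         (λ { (wss , len , vd) → wss , len , VertexDisjointPaths.paths vd , vd })
         (∃-ofLength? ∃path? k vertexDisjointPaths?)

  secondVertex : List (Fin p) → Fin p
  secondVertex []      = v
  secondVertex (w ∷ _) = w

  secondVertex-unique : ∀ {wss} → VertexDisjointPaths M u v wss → Unique (map secondVertex wss)
  secondVertex-unique (mkVertexDisjointPaths ps ne dj) = AllPairs.map⁺ (go ps ne dj)
    where
    differ : ∀ {ws ws′} → IsPath M u v ws → IsPath M u v ws′ → ws ≢ ws′ → Disjoint ws ws′ →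
             secondVertex ws ≢ secondVertex ws′
    differ {[]}    {[]}    _ _  ne _  _    = ne refl
    differ {[]}    {_ ∷ _} _ q  _  _  refl = proj₂ (path-interior q) (here refl)
    differ {_ ∷ _} {[]}    q _  _  _  refl = proj₂ (path-interior q) (here refl)
    differ {_ ∷ _} {_ ∷ _} _ _  _  dj refl = dj (here refl , here refl)

    differAll : ∀ {ws wss} → IsPath M u v ws → All (IsPath M u v) wss → All (ws ≢_) wss →
                All (Disjoint ws) wss → All (λ ws′ → secondVertex ws ≢ secondVertex ws′) wss
    differAll q []       []       []       = []
    differAll q (r ∷ rs) (n ∷ ns) (d ∷ ds) = differ q r n d ∷ differAll q rs ns ds

    go : ∀ {wss} → All (IsPath M u v) wss → Unique wss → AllPairs Disjoint wss →
         AllPairs (λ ws ws′ → secondVertex ws ≢ secondVertex ws′) wss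
    go []       []       []       = []
    go (q ∷ qs) (n ∷ ns) (d ∷ ds) = differAll q qs n d ∷ go qs ns ds

  disjointPaths-length≤ : ∀ wss → VertexDisjointPaths M u v wss → length wss ℕ.≤ p
  disjointPaths-length≤ wss vd =
    subst (ℕ._≤ p) (List.length-map secondVertex wss) (unique⇒length≤ (secondVertex-unique vd))

  ∃maxDisjointPaths : ∃ (IsMaxDisjointPaths M u v)
  ∃maxDisjointPaths
    with m , attained , ub ← greatest ∃disjointPaths? ([] , refl , mkVertexDisjointPaths [] [] []) p
           (λ { n (wss , refl , vd) → disjointPaths-length≤ wss vd })
    = m , mkIsMaxDisjointPaths attained (λ wss vd → ub (length wss) (wss , refl , vd))

  maxDisjointPaths : ℕ
  maxDisjointPaths = proj₁ ∃maxDisjointPaths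

------------------------------------------------------------------------
-- Real numbers, as Cauchy sequences of rationals

record ℝ : Set where
  constructor mkℝ
  field
    seq    : ℕ → ℚ
    cauchy : ∀ ε → 0ℚ ℚ.< ε → ∃ λ N → ∀ m n → N ℕ.≤ m → N ℕ.≤ n →
             ℚ.∣ seq m ℚ.- seq n ∣ ℚ.< ε
open ℝ

infix 4 _≃_ _≤_

_≃_ : Rel ℝ 0ℓ
x ≃ y = ∀ ε → 0ℚ ℚ.< ε → ∃ λ N → ∀ n → N ℕ.≤ n → ℚ.∣ seq x n ℚ.- seq y n ∣ ℚ.< ε

_≤_ : Rel ℝ 0ℓ
x ≤ y = ∀ ε → 0ℚ ℚ.< ε → ∃ λ N → ∀ n → N ℕ.≤ n → seq x n ℚ.< seq y n ℚ.+ ε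

fromℚ : ℚ → ℝ
fromℚ q = mkℝ (λ _ → q) λ ε ε>0 → 0 , λ _ _ _ _ →
  subst (ℚ._< ε) (cong ℚ.∣_∣ (sym (ℚ.+-inverseʳ q))) ε>0

fromℕ : ℕ → ℝ
fromℕ n = fromℚ (ℤ.+ n ℚ./ 1)

0ℝ 1ℝ : ℝ
0ℝ = fromℚ 0ℚ
1ℝ = fromℚ 1ℚ

private
  half>0 : ∀ {ε} → 0ℚ ℚ.< ε → 0ℚ ℚ.< ε ℚ.* ½
  half>0 {ε} ε>0 = subst (ℚ._< ε ℚ.* ½) (ℚ.*-zeroˡ ½) (ℚ.*-monoˡ-<-pos ½ ε>0)

  half+half : ∀ ε → ε ℚ.* ½ ℚ.+ ε ℚ.* ½ ≡ ε
  half+half ε = trans (sym (ℚ.*-distribˡ-+ ε ½ ½)) (ℚ.*-identityʳ ε)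

infixl 6 _+_ _-_
infixl 7 _*_
infix  8 -_

_+_ : ℝ → ℝ → ℝ
x + y = mkℝ (λ n → seq x n ℚ.+ seq y n) λ ε ε>0 →
  let N₁ , h₁ = cauchy x (ε ℚ.* ½) (half>0 ε>0)
      N₂ , h₂ = cauchy y (ε ℚ.* ½) (half>0 ε>0)
  in N₁ ℕ.⊔ N₂ , λ m n N≤m N≤n → begin-strict
    ℚ.∣ (seq x m ℚ.+ seq y m) ℚ.- (seq x n ℚ.+ seq y n) ∣
      ≡⟨ cong ℚ.∣_∣ (regroup (seq x m) (seq y m) (seq x n) (seq y n)) ⟩
    ℚ.∣ (seq x m ℚ.- seq x n) ℚ.+ (seq y m ℚ.- seq y n) ∣
      ≤⟨ ℚ.∣p+q∣≤∣p∣+∣q∣ (seq x m ℚ.- seq x n) (seq y m ℚ.- seq y n) ⟩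
    ℚ.∣ seq x m ℚ.- seq x n ∣ ℚ.+ ℚ.∣ seq y m ℚ.- seq y n ∣
      <⟨ ℚ.+-mono-< (h₁ m n (ℕ.m⊔n≤o⇒m≤o N₁ N₂ N≤m) (ℕ.m⊔n≤o⇒m≤o N₁ N₂ N≤n))
                    (h₂ m n (ℕ.m⊔n≤o⇒n≤o N₁ N₂ N≤m) (ℕ.m⊔n≤o⇒n≤o N₁ N₂ N≤n)) ⟩
    ε ℚ.* ½ ℚ.+ ε ℚ.* ½
      ≡⟨ half+half ε ⟩
    ε ∎
  where
  open ℚ.≤-Reasoning
  open +-*-Solver
  regroup : ∀ a b c d → (a ℚ.+ b) ℚ.- (c ℚ.+ d) ≡ (a ℚ.- c) ℚ.+ (b ℚ.- d)
  regroup = solve 4 (λ a b c d → (a :+ b) :- (c :+ d) := (a :- c) :+ (b :- d)) refl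

-_ : ℝ → ℝ
- x = mkℝ (λ n → ℚ.- seq x n) λ ε ε>0 →
  let N , h = cauchy x ε ε>0
  in N , λ m n N≤m N≤n →
    subst (ℚ._< ε)
          (trans (sym (ℚ.∣-p∣≡∣p∣ (seq x m ℚ.- seq x n)))
                 (cong ℚ.∣_∣ (ℚ.neg-distrib-+ (seq x m) (ℚ.- seq x n))))
          (h m n N≤m N≤n)

_-_ : ℝ → ℝ → ℝ
x - y = x + - y

∣_∣ : ℝ → ℝ
∣ x ∣ = mkℝ (λ n → ℚ.∣ seq x n ∣) λ ε ε>0 →
  let N , h = cauchy x ε ε>0
  in N , λ m n N≤m N≤n → ℚ.≤-<-trans (reverse-triangle (seq x m) (seq x n)) (h m n N≤m N≤n)
  where
  open +-*-Solver
  half-triangle : ∀ a b → ℚ.∣ a ∣ ℚ.- ℚ.∣ b ∣ ℚ.≤ ℚ.∣ a ℚ.- b ∣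
  half-triangle a b = begin
    ℚ.∣ a ∣ ℚ.- ℚ.∣ b ∣
      ≡⟨ cong (λ z → ℚ.∣ z ∣ ℚ.- ℚ.∣ b ∣)
              (solve 2 (λ a b → a := (a :- b) :+ b) refl a b) ⟩
    ℚ.∣ (a ℚ.- b) ℚ.+ b ∣ ℚ.- ℚ.∣ b ∣
      ≤⟨ ℚ.+-monoˡ-≤ (ℚ.- ℚ.∣ b ∣) (ℚ.∣p+q∣≤∣p∣+∣q∣ (a ℚ.- b) b) ⟩
    (ℚ.∣ a ℚ.- b ∣ ℚ.+ ℚ.∣ b ∣) ℚ.- ℚ.∣ b ∣
      ≡⟨ solve 2 (λ c d → (c :+ d) :- d := c) refl ℚ.∣ a ℚ.- b ∣ ℚ.∣ b ∣ ⟩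
    ℚ.∣ a ℚ.- b ∣ ∎
    where open ℚ.≤-Reasoning
  swap : ∀ a b → ℚ.- (a ℚ.- b) ≡ b ℚ.- a
  swap = solve 2 (λ a b → :- (a :- b) := b :- a) refl
  reverse-triangle : ∀ a b → ℚ.∣ ℚ.∣ a ∣ ℚ.- ℚ.∣ b ∣ ∣ ℚ.≤ ℚ.∣ a ℚ.- b ∣
  reverse-triangle a b with ℚ.∣p∣≡p∨∣p∣≡-p (ℚ.∣ a ∣ ℚ.- ℚ.∣ b ∣)
  ... | inj₁ eq = subst (ℚ._≤ ℚ.∣ a ℚ.- b ∣) (sym eq) (half-triangle a b)
  ... | inj₂ eq = begin
    ℚ.∣ ℚ.∣ a ∣ ℚ.- ℚ.∣ b ∣ ∣  ≡⟨ trans eq (swap ℚ.∣ a ∣ ℚ.∣ b ∣) ⟩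
    ℚ.∣ b ∣ ℚ.- ℚ.∣ a ∣        ≤⟨ half-triangle b a ⟩
    ℚ.∣ b ℚ.- a ∣              ≡⟨ trans (cong ℚ.∣_∣ (sym (swap a b))) (ℚ.∣-p∣≡∣p∣ (a ℚ.- b)) ⟩
    ℚ.∣ a ℚ.- b ∣              ∎
    where open ℚ.≤-Reasoning

eventuallyBounded : ∀ x → ∃ λ K → 0ℚ ℚ.< K × ∃ λ N → ∀ n → N ℕ.≤ n → ℚ.∣ seq x n ∣ ℚ.< K
eventuallyBounded x with cauchy x 1ℚ (ℚ.positive⁻¹ 1ℚ)
... | N , h = K , K>0 , N , bound
  where
  K = 1ℚ ℚ.+ ℚ.∣ seq x N ∣
  bound : ∀ n → N ℕ.≤ n → ℚ.∣ seq x n ∣ ℚ.< K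
  bound n N≤n = begin-strict
    ℚ.∣ seq x n ∣
      ≡⟨ cong ℚ.∣_∣ (solve 2 (λ a b → a := (a :- b) :+ b) refl (seq x n) (seq x N)) ⟩
    ℚ.∣ (seq x n ℚ.- seq x N) ℚ.+ seq x N ∣
      ≤⟨ ℚ.∣p+q∣≤∣p∣+∣q∣ (seq x n ℚ.- seq x N) (seq x N) ⟩
    ℚ.∣ seq x n ℚ.- seq x N ∣ ℚ.+ ℚ.∣ seq x N ∣
      <⟨ ℚ.+-monoˡ-< ℚ.∣ seq x N ∣ (h n N N≤n ℕ.≤-refl) ⟩
    K ∎
    where
    open ℚ.≤-Reasoning
    open +-*-Solver
  K>0 : 0ℚ ℚ.< K
  K>0 = ℚ.≤-<-trans (ℚ.0≤∣p∣ (seq x N)) (bound N ℕ.≤-refl)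

private
  quotient : ∀ K → 0ℚ ℚ.< K → ∀ ε → 0ℚ ℚ.< ε → ∃ λ δ → 0ℚ ℚ.< δ × K ℚ.* δ ≡ ε
  quotient K K>0 ε ε>0 = K⁻¹ ℚ.* ε , δ>0 ,
    trans (sym (ℚ.*-assoc K K⁻¹ ε)) (trans (cong (ℚ._* ε) (ℚ.*-inverseʳ K)) (ℚ.*-identityˡ ε))
    where
    instance
      K-pos : ℚ.Positive K
      K-pos = ℚ.positive K>0
      K-nonZero : ℚ.NonZero K
      K-nonZero = ℚ.pos⇒nonZero K
    K⁻¹ = ℚ.1/ K
    instance
      K⁻¹-pos : ℚ.Positive K⁻¹
      K⁻¹-pos = ℚ.1/pos⇒pos K
    δ>0 : 0ℚ ℚ.< K⁻¹ ℚ.* ε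
    δ>0 = subst (ℚ._< K⁻¹ ℚ.* ε) (ℚ.*-zeroʳ K⁻¹) (ℚ.*-monoʳ-<-pos K⁻¹ ε>0)

  ∣*∣-< : ∀ {a b K δ} → 0ℚ ℚ.< K → ℚ.∣ a ∣ ℚ.< K → ℚ.∣ b ∣ ℚ.< δ → ℚ.∣ a ℚ.* b ∣ ℚ.< K ℚ.* δ
  ∣*∣-< {a} {b} {K} {δ} K>0 a<K b<δ = begin-strict
    ℚ.∣ a ℚ.* b ∣          ≡⟨ ℚ.∣p*q∣≡∣p∣*∣q∣ a b ⟩
    ℚ.∣ a ∣ ℚ.* ℚ.∣ b ∣    ≤⟨ ℚ.*-monoʳ-≤-nonNeg ℚ.∣ b ∣ {{ℚ.nonNegative (ℚ.0≤∣p∣ b)}} (ℚ.<⇒≤ a<K) ⟩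
    K ℚ.* ℚ.∣ b ∣          <⟨ ℚ.*-monoʳ-<-pos K {{ℚ.positive K>0}} b<δ ⟩
    K ℚ.* δ                ∎
    where open ℚ.≤-Reasoning

_*_ : ℝ → ℝ → ℝ
x * y = mkℝ (λ n → seq x n ℚ.* seq y n) λ ε ε>0 →
  let K , K>0 , Nx , x<K = eventuallyBounded x
      L , L>0 , Ny , y<L = eventuallyBounded y
      δ , δ>0 , Kδ = quotient K K>0 (ε ℚ.* ½) (half>0 ε>0)
      η , η>0 , Lη = quotient L L>0 (ε ℚ.* ½) (half>0 ε>0)
      Nδ , hy = cauchy y δ δ>0
      Nη , hx = cauchy x η η>0
      A = Nx ℕ.⊔ Ny
      B = Nδ ℕ.⊔ Nη
      Nx≤ : ∀ {n} → A ℕ.⊔ B ℕ.≤ n → Nx ℕ.≤ n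
      Nx≤ le = ℕ.m⊔n≤o⇒m≤o Nx Ny (ℕ.m⊔n≤o⇒m≤o A B le)
      Ny≤ : ∀ {n} → A ℕ.⊔ B ℕ.≤ n → Ny ℕ.≤ n
      Ny≤ le = ℕ.m⊔n≤o⇒n≤o Nx Ny (ℕ.m⊔n≤o⇒m≤o A B le)
      Nδ≤ : ∀ {n} → A ℕ.⊔ B ℕ.≤ n → Nδ ℕ.≤ n
      Nδ≤ le = ℕ.m⊔n≤o⇒m≤o Nδ Nη (ℕ.m⊔n≤o⇒n≤o A B le)
      Nη≤ : ∀ {n} → A ℕ.⊔ B ℕ.≤ n → Nη ℕ.≤ n
      Nη≤ le = ℕ.m⊔n≤o⇒n≤o Nδ Nη (ℕ.m⊔n≤o⇒n≤o A B le)
  in A ℕ.⊔ B , λ m n ≤m ≤n → begin-strict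
    ℚ.∣ seq x m ℚ.* seq y m ℚ.- seq x n ℚ.* seq y n ∣
      ≡⟨ cong ℚ.∣_∣ (regroup (seq x m) (seq y m) (seq x n) (seq y n)) ⟩
    ℚ.∣ seq x m ℚ.* (seq y m ℚ.- seq y n) ℚ.+ seq y n ℚ.* (seq x m ℚ.- seq x n) ∣
      ≤⟨ ℚ.∣p+q∣≤∣p∣+∣q∣ (seq x m ℚ.* (seq y m ℚ.- seq y n)) (seq y n ℚ.* (seq x m ℚ.- seq x n)) ⟩
    ℚ.∣ seq x m ℚ.* (seq y m ℚ.- seq y n) ∣ ℚ.+ ℚ.∣ seq y n ℚ.* (seq x m ℚ.- seq x n) ∣
      <⟨ ℚ.+-mono-<
           (∣*∣-< {seq x m} {seq y m ℚ.- seq y n} K>0 (x<K m (Nx≤ ≤m)) (hy m n (Nδ≤ ≤m) (Nδ≤ ≤n)))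
           (∣*∣-< {seq y n} {seq x m ℚ.- seq x n} L>0 (y<L n (Ny≤ ≤n)) (hx m n (Nη≤ ≤m) (Nη≤ ≤n))) ⟩
    K ℚ.* δ ℚ.+ L ℚ.* η
      ≡⟨ cong₂ ℚ._+_ Kδ Lη ⟩
    ε ℚ.* ½ ℚ.+ ε ℚ.* ½
      ≡⟨ half+half ε ⟩
    ε ∎
  where
  open ℚ.≤-Reasoning
  open +-*-Solver
  regroup : ∀ a b c d → a ℚ.* b ℚ.- c ℚ.* d ≡ a ℚ.* (b ℚ.- d) ℚ.+ d ℚ.* (a ℚ.- c)
  regroup = solve 4 (λ a b c d → a :* b :- c :* d := a :* (b :- d) :+ d :* (a :- c)) refl

ℝ-rawRing : RawRing 0ℓ 0ℓ
ℝ-rawRing = record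
  { Carrier = ℝ ; _≈_ = _≃_ ; _+_ = _+_ ; _*_ = _*_ ; -_ = -_ ; 0# = 0ℝ ; 1# = 1ℝ }

------------------------------------------------------------------------
-- Determinants and characteristic polynomials

module Determinant {c ℓ} (R : RawRing c ℓ) where
  private module R = RawRing R
  open RawSemiringDefs R.rawSemiring using (sum; _^_)

  Matrix : ℕ → Set c
  Matrix n = Fin n → Fin n → R.Carrier

  identity : ∀ {n} → Matrix n
  identity i j = if does (i Fin.≟ j) then R.1# else R.0#

  minor : ∀ {n} → Matrix (suc n) → Fin (suc n) → Matrix n
  minor A j i k = A (suc i) (punchIn j k)

  -- Laplace expansion along the first row.
  det : ∀ {n} → Matrix n → R.Carrier
  det {zero}  A = R.1#
  det {suc n} A = sum λ j → (R.- R.1#) ^ toℕ j R.* A zero j R.* det (minor A j)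

  -- The value at x of the characteristic polynomial det (x I − A).
  charPoly : ∀ {n} → Matrix n → R.Carrier → R.Carrier
  charPoly A x = det λ i j → x R.* identity i j R.+ R.- A i j

open Determinant ℝ-rawRing public using () renaming (Matrix to ℝMatrix; charPoly to charPolyℝ)
open RawSemiringDefs (RawRing.rawSemiring ℝ-rawRing) public
  using () renaming (sum to sumℝ; product to productℝ)

-- μ lists the eigenvalues of A with multiplicity: the characteristic
-- polynomial is ∏ᵢ (x − μᵢ).  Two real polynomials agree exactly when
-- they take the same value at every real x.
IsSpectrum : ∀ {n} → ℝMatrix n → Vector ℝ n → Set
IsSpectrum A μ = ∀ x → charPolyℝ A x ≃ productℝ (λ i → x - μ i)

------------------------------------------------------------------------
-- Path energy

pathMatrix : ∀ {p} → Graph p → ℝMatrix p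
pathMatrix M i j = if does (i Fin.≟ j) then 0ℝ else fromℕ (maxDisjointPaths M i j)

-- The energy is specified by a relation because the eigenvalues exist
-- by the spectral theorem rather than by an explicit formula.  It
-- determines E up to ≃, the list of roots being unique up to order.
IsPathEnergy : ∀ {p} → Graph p → ℝ → Set
IsPathEnergy M E = ∃ λ μ → IsSpectrum (pathMatrix M) μ × E ≃ sumℝ (λ i → ∣ μ i ∣)

{-# OPTIONS --safe #-}

-- Every path eigenvalue μ satisfies |μ| ≤ (p − 1)Δ, because the entries of
-- the path matrix are at most Δ (disjoint paths from u have distinct second
-- vertices, all neighbours of u) and its diagonal vanishes, so that its
-- absolute row sums are at most (p − 1)Δ.
--
-- For the eigenvalue bound, evaluate everything at a fixed index of the Cauchy
-- sequences, i.e. over ℚ.  If |q| ≥ (p − 1)Δ + δ then qI − A is diagonally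
-- dominant with margin δ, and this forces |det (qI − A)| ≥ δᵖ.  Since the
-- characteristic polynomial vanishes at μ, its approximations cannot stay
-- above δᵖ.
--
-- The determinant bound is by induction along the Laplace expansion.  The
-- cofactors c of the first row satisfy Σⱼ aᵢⱼ cⱼ = 0 for every other row i, so
-- by dominance of that row cᵢ cannot be a nonzero cofactor of largest modulus;
-- hence c₀ is one, and dominance of the first row gives |det A| ≥ δ|c₀|.

module Submission where

open import Defs
open import Data.Nat.Base using (ℕ; _∸_) renaming (_*_ to _*ℕ_)

open import Algebra.Bundles using (CommutativeRing; RawRing)
import Algebra.Definitions.RawSemiring as RawSemiringDefs
import Algebra.Properties.Semiring.Sum as SemiringSum
open import Data.Bool.Base using (true; false; if_then_else_)
open import Data.Fin.Base using (Fin; zero; suc; toℕ; punchIn; pinch)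
import Data.Fin.Properties as Fin
import Data.Integer.Base as ℤ
import Data.Integer.Properties as ℤ
open import Data.List.Base using (List; []; _∷_; length; map; allFin; filter; lookup)
import Data.List.Properties as List
open import Data.List.Extrema.Nat using (xs≤max)
open import Data.List.Membership.Propositional using (_∈_)
open import Data.List.Membership.Propositional.Properties
  using (∈-allFin; ∈-filter⁺; ∈-map⁺; ∈-map⁻; ∈-lookup)
open import Data.List.Relation.Binary.Subset.Propositional using (_⊆_)
import Data.List.Relation.Unary.All as All
open import Data.List.Relation.Unary.Any using (index)
open import Data.List.Relation.Unary.Any.Properties using (lookup-index)
open import Data.List.Relation.Unary.Linked using (_∷_)
open import Data.List.Relation.Unary.Unique.Propositional using (Unique)
open import Data.Nat.Base as ℕ using (zero; suc)
import Data.Nat.Properties as ℕ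
open import Data.Product.Base using (∃; _×_; _,_; proj₁; proj₂)
open import Data.Rational.Base as ℚ using (ℚ; 0ℚ; 1ℚ; ½)
import Data.Rational.Properties as ℚ
open import Data.Rational.Solver using (module +-*-Solver)
import Data.Rational.Unnormalised.Base as ℚᵘ
import Data.Rational.Unnormalised.Properties as ℚᵘ
open import Data.Sum.Base using (inj₁; inj₂)
open import Data.Vec.Functional using (Vector)
open import Function.Base using (_∘_)
open import Relation.Binary.PropositionalEquality
  using (_≡_; _≢_; refl; sym; trans; cong; cong₂; subst; module ≡-Reasoning)
open import Relation.Nullary using (Dec; does; yes; no; contradiction)

open ℝ
open SemiringSum (CommutativeRing.semiring ℚ.+-*-commutativeRing)
  using (sum; sum-cong-≗; ∑-distrib-+; *-distribˡ-sum; *-distribʳ-sum)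
open RawSemiringDefs (RawRing.rawSemiring ℚ.+-*-rawRing) using (_^_)
open Determinant ℚ.+-*-rawRing using (Matrix; identity; minor; det; charPoly)

-- Finite sums of rationals

sum-neg : ∀ {n} (f : Vector ℚ n) → sum (λ i → ℚ.- f i) ≡ ℚ.- sum f
sum-neg {zero}  f = refl
sum-neg {suc n} f = trans (cong (ℚ.- f zero ℚ.+_) (sum-neg (f ∘ suc)))
                          (sym (ℚ.neg-distrib-+ (f zero) (sum (f ∘ suc))))

sum-mono : ∀ {n} {f g : Vector ℚ n} → (∀ i → f i ℚ.≤ g i) → sum f ℚ.≤ sum g
sum-mono {zero}  f≤g = ℚ.≤-refl
sum-mono {suc n} f≤g = ℚ.+-mono-≤ (f≤g zero) (sum-mono (f≤g ∘ suc))

-- With `g i` added on the left and `f i` on the right, only the indices other than `i` have to be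
-- compared, and no sum over a punctured index set occurs. It serves to compare matrix rows off the
-- diagonal.
sum-mono-except : ∀ {n} {f g : Vector ℚ n} i → (∀ j → i ≢ j → f j ℚ.≤ g j) →
                  sum f ℚ.+ g i ℚ.≤ f i ℚ.+ sum g
sum-mono-except {f = f} {g} zero f≤g = begin
  (f zero ℚ.+ sum (f ∘ suc)) ℚ.+ g zero  ≡⟨ regroup (f zero) (sum (f ∘ suc)) (g zero) ⟩
  f zero ℚ.+ (g zero ℚ.+ sum (f ∘ suc))
    ≤⟨ ℚ.+-monoʳ-≤ (f zero) (ℚ.+-monoʳ-≤ (g zero) (sum-mono λ j → f≤g (suc j) λ ())) ⟩
  f zero ℚ.+ (g zero ℚ.+ sum (g ∘ suc))  ∎
  where
  open ℚ.≤-Reasoning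
  open +-*-Solver
  regroup : ∀ a b c → (a ℚ.+ b) ℚ.+ c ≡ a ℚ.+ (c ℚ.+ b)
  regroup = solve 3 (λ a b c → (a :+ b) :+ c := a :+ (c :+ b)) refl
sum-mono-except {f = f} {g} (suc i) f≤g = begin
  (f zero ℚ.+ sum (f ∘ suc)) ℚ.+ g (suc i)  ≡⟨ ℚ.+-assoc (f zero) (sum (f ∘ suc)) (g (suc i)) ⟩
  f zero ℚ.+ (sum (f ∘ suc) ℚ.+ g (suc i))
    ≤⟨ ℚ.+-mono-≤ (f≤g zero λ ())
         (sum-mono-except i λ j i≢j → f≤g (suc j) (i≢j ∘ Fin.suc-injective)) ⟩
  g zero ℚ.+ (f (suc i) ℚ.+ sum (g ∘ suc))  ≡⟨ regroup (g zero) (f (suc i)) (sum (g ∘ suc)) ⟩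
  f (suc i) ℚ.+ (g zero ℚ.+ sum (g ∘ suc))  ∎
  where
  open ℚ.≤-Reasoning
  open +-*-Solver
  regroup : ∀ a b c → a ℚ.+ (b ℚ.+ c) ≡ b ℚ.+ (a ℚ.+ c)
  regroup = solve 3 (λ a b c → a :+ (b :+ c) := b :+ (a :+ c)) refl

∣sum∣≤sum∣∣ : ∀ {n} (f : Vector ℚ n) → ℚ.∣ sum f ∣ ℚ.≤ sum (λ i → ℚ.∣ f i ∣)
∣sum∣≤sum∣∣ {zero}  f = ℚ.≤-refl
∣sum∣≤sum∣∣ {suc n} f = ℚ.≤-trans (ℚ.∣p+q∣≤∣p∣+∣q∣ (f zero) (sum (f ∘ suc)))
                                  (ℚ.+-monoʳ-≤ ℚ.∣ f zero ∣ (∣sum∣≤sum∣∣ (f ∘ suc)))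

∣q∣≤∣p+q∣+∣p∣ : ∀ p q → ℚ.∣ q ∣ ℚ.≤ ℚ.∣ p ℚ.+ q ∣ ℚ.+ ℚ.∣ p ∣
∣q∣≤∣p+q∣+∣p∣ p q = begin
  ℚ.∣ q ∣                      ≡⟨ cong ℚ.∣_∣ (solve 2 (λ p q → q := (p :+ q) :- p) refl p q) ⟩
  ℚ.∣ (p ℚ.+ q) ℚ.- p ∣        ≤⟨ ℚ.∣p-q∣≤∣p∣+∣q∣ (p ℚ.+ q) p ⟩
  ℚ.∣ p ℚ.+ q ∣ ℚ.+ ℚ.∣ p ∣    ∎
  where
  open ℚ.≤-Reasoning
  open +-*-Solver

-- The triangle inequality |wₘ| ≤ |Σ w| + Σ_{j ≠ m} |wⱼ| with |wₘ| added on
-- both sides, so that no sum omits an index.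
∣summand∣≤ : ∀ {n} (w : Vector ℚ n) m →
             ℚ.∣ w m ∣ ℚ.+ ℚ.∣ w m ∣ ℚ.≤ ℚ.∣ sum w ∣ ℚ.+ sum (λ i → ℚ.∣ w i ∣)
∣summand∣≤ w zero = begin
  a ℚ.+ a
    ≤⟨ ℚ.+-monoʳ-≤ a (subst (λ z → a ℚ.≤ ℚ.∣ z ∣ ℚ.+ ℚ.∣ s ∣) (ℚ.+-comm s (w zero))
                            (∣q∣≤∣p+q∣+∣p∣ s (w zero))) ⟩
  a ℚ.+ (ℚ.∣ w zero ℚ.+ s ∣ ℚ.+ ℚ.∣ s ∣)
    ≤⟨ ℚ.+-monoʳ-≤ a (ℚ.+-monoʳ-≤ ℚ.∣ w zero ℚ.+ s ∣ (∣sum∣≤sum∣∣ (w ∘ suc))) ⟩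
  a ℚ.+ (ℚ.∣ w zero ℚ.+ s ∣ ℚ.+ t)  ≡⟨ regroup a ℚ.∣ w zero ℚ.+ s ∣ t ⟩
  ℚ.∣ w zero ℚ.+ s ∣ ℚ.+ (a ℚ.+ t)  ∎
  where
  open ℚ.≤-Reasoning
  open +-*-Solver
  a = ℚ.∣ w zero ∣
  s = sum (w ∘ suc)
  t = sum (λ i → ℚ.∣ w (suc i) ∣)
  regroup : ∀ a b c → a ℚ.+ (b ℚ.+ c) ≡ b ℚ.+ (a ℚ.+ c)
  regroup = solve 3 (λ a b c → a :+ (b :+ c) := b :+ (a :+ c)) refl
∣summand∣≤ w (suc m) = begin
  ℚ.∣ w (suc m) ∣ ℚ.+ ℚ.∣ w (suc m) ∣           ≤⟨ ∣summand∣≤ (w ∘ suc) m ⟩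
  ℚ.∣ s ∣ ℚ.+ t                                 ≤⟨ ℚ.+-monoˡ-≤ t (∣q∣≤∣p+q∣+∣p∣ (w zero) s) ⟩
  (ℚ.∣ w zero ℚ.+ s ∣ ℚ.+ ℚ.∣ w zero ∣) ℚ.+ t   ≡⟨ ℚ.+-assoc ℚ.∣ w zero ℚ.+ s ∣ ℚ.∣ w zero ∣ t ⟩
  ℚ.∣ w zero ℚ.+ s ∣ ℚ.+ (ℚ.∣ w zero ∣ ℚ.+ t)   ∎
  where
  open ℚ.≤-Reasoning
  s = sum (w ∘ suc)
  t = sum (λ i → ℚ.∣ w (suc i) ∣)

argmax : ∀ {n} (f : Vector ℚ (suc n)) → ∃ λ m → ∀ j → f j ℚ.≤ f m
argmax {zero}  f = zero , λ { zero → ℚ.≤-refl }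
argmax {suc n} f with m , f≤ ← argmax (f ∘ suc) | ℚ.≤-total (f zero) (f (suc m))
... | inj₁ f₀≤ = suc m , λ { zero → f₀≤ ; (suc j) → f≤ j }
... | inj₂ ≤f₀ = zero , λ { zero → ℚ.≤-refl ; (suc j) → ℚ.≤-trans (f≤ j) ≤f₀ }

-- The determinant is alternating

-- (j , k) ↦ (punchIn j k , pinch k j) exchanges the components of an ordered
-- pair of distinct indices when the pair (j , punchIn j k) is encoded as (j , k).
sum-exchange : ∀ {n} (G : Fin (suc n) → Fin n → ℚ) →
               sum (λ j → sum λ k → G (punchIn j k) (pinch k j)) ≡ sum (λ j → sum (G j))
sum-exchange {zero}  G = refl
sum-exchange {suc n} G = begin
  -- The pairs with a `zero` component trade places: `j` equal to `zero` yields `s₁`, and `k` equal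
  -- to `zero` under a successor `j` yields `s₀`. The rest is the same exchange one index up.
  s₁ ℚ.+ sum (λ j → G zero j ℚ.+ sum λ k → G (suc (punchIn j k)) (suc (pinch k j)))
    ≡⟨ cong (s₁ ℚ.+_) (∑-distrib-+ (G zero) λ j →
         sum λ k → G (suc (punchIn j k)) (suc (pinch k j))) ⟩
  s₁ ℚ.+ (s₀ ℚ.+ sum (λ j → sum λ k → G (suc (punchIn j k)) (suc (pinch k j))))
    ≡⟨ cong (λ z → s₁ ℚ.+ (s₀ ℚ.+ z)) (sum-exchange λ j k → G (suc j) (suc k)) ⟩
  s₁ ℚ.+ (s₀ ℚ.+ s)
    ≡⟨ solve 3 (λ a b c → a :+ (b :+ c) := b :+ (a :+ c)) refl s₁ s₀ s ⟩
  s₀ ℚ.+ (s₁ ℚ.+ s)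
    ≡⟨ cong (s₀ ℚ.+_) (∑-distrib-+ (λ j → G (suc j) zero) λ j →
         sum λ k → G (suc j) (suc k)) ⟨
  s₀ ℚ.+ sum (λ j → sum (G (suc j)))
    ∎
  where
  open ≡-Reasoning
  open +-*-Solver
  s₀ = sum (G zero)
  s₁ = sum λ j → G (suc j) zero
  s  = sum λ j → sum λ k → G (suc j) (suc k)

-- The exchanged pair has `j` as its second component; its first is `punchIn j k` by construction.
punchIn-pinch : ∀ {n} (j : Fin (suc n)) (k : Fin n) → punchIn (punchIn j k) (pinch k j) ≡ j
punchIn-pinch {suc n} zero    k       = refl
punchIn-pinch {suc n} (suc j) zero    = refl
punchIn-pinch {suc n} (suc j) (suc k) = cong suc (punchIn-pinch j k)

-- Deleting two columns leaves the same columns in the same order, whichever goes first, so the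
-- double minors of a pair and of its exchange agree.
punchIn-punchIn-pinch : ∀ {n} (j : Fin (suc (suc n))) (k : Fin (suc n)) (l : Fin n) →
  punchIn (punchIn j k) (punchIn (pinch k j) l) ≡ punchIn j (punchIn k l)
punchIn-punchIn-pinch zero    k       l       = refl
punchIn-punchIn-pinch (suc j) zero    l       = refl
punchIn-punchIn-pinch (suc j) (suc k) zero    = refl
punchIn-punchIn-pinch (suc j) (suc k) (suc l) = cong suc (punchIn-punchIn-pinch j k l)

sign : ∀ {n} → Fin n → ℚ
sign j = (ℚ.- 1ℚ) ^ toℕ j

-- For `k` less than `j` the exchange of `(j , k)` is `(k , j - 1)`, otherwise `(k + 1 , j)`. The
-- sum of the exponents changes by one, so the sign flips.
sign-exchange : ∀ {n} (j : Fin (suc n)) (k : Fin n) →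
                sign (punchIn j k) ℚ.* sign (pinch k j) ≡ ℚ.- (sign j ℚ.* sign k)
sign-exchange {suc n} zero k =
  solve 1 (λ s → (con (ℚ.- 1ℚ) :* s) :* con 1ℚ := :- (con 1ℚ :* s)) refl (sign k)
  where open +-*-Solver
sign-exchange {suc n} (suc j) zero =
  solve 1 (λ s → con 1ℚ :* s := :- ((con (ℚ.- 1ℚ) :* s) :* con 1ℚ)) refl (sign j)
  where open +-*-Solver
sign-exchange {suc n} (suc j) (suc k) = begin
  (ℚ.- 1ℚ ℚ.* sign (punchIn j k)) ℚ.* (ℚ.- 1ℚ ℚ.* sign (pinch k j))
    ≡⟨ cancel (sign (punchIn j k)) (sign (pinch k j)) ⟩
  sign (punchIn j k) ℚ.* sign (pinch k j)
    ≡⟨ sign-exchange j k ⟩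
  ℚ.- (sign j ℚ.* sign k)
    ≡⟨ cong ℚ.-_ (cancel (sign j) (sign k)) ⟨
  ℚ.- ((ℚ.- 1ℚ ℚ.* sign j) ℚ.* (ℚ.- 1ℚ ℚ.* sign k)) ∎
  where
  open ≡-Reasoning
  open +-*-Solver
  cancel : ∀ a b → (ℚ.- 1ℚ ℚ.* a) ℚ.* (ℚ.- 1ℚ ℚ.* b) ≡ a ℚ.* b
  cancel = solve 2 (λ a b → (con (ℚ.- 1ℚ) :* a) :* (con (ℚ.- 1ℚ) :* b) := a :* b) refl

det-cong : ∀ {n} {A B : Matrix n} → (∀ i j → A i j ≡ B i j) → det A ≡ det B
det-cong {zero}  A≡B = refl
det-cong {suc n} A≡B = sum-cong-≗ λ j →
  cong₂ ℚ._*_ (cong (sign j ℚ.*_) (A≡B zero j))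
              (det-cong λ i k → A≡B (suc i) (punchIn j k))

minor₂ : ∀ {n} → Matrix (suc (suc n)) → Fin (suc (suc n)) → Fin (suc n) → Matrix n
minor₂ A j k = minor (minor A j) k

laplaceTerm₂ : ∀ {n} → Matrix (suc (suc n)) → Fin (suc (suc n)) → Fin (suc n) → ℚ
laplaceTerm₂ A j k =
  (sign j ℚ.* sign k) ℚ.* (A zero j ℚ.* A (suc zero) (punchIn j k)) ℚ.* det (minor₂ A j k)

det-laplace₂ : ∀ {n} (A : Matrix (suc (suc n))) → det A ≡ sum λ j → sum (laplaceTerm₂ A j)
det-laplace₂ A = sum-cong-≗ λ j → trans
  (*-distribˡ-sum (sign j ℚ.* A zero j)
    (λ k → sign k ℚ.* A (suc zero) (punchIn j k) ℚ.* det (minor₂ A j k)))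
  (sum-cong-≗ λ k →
    solve 5 (λ s a t b d → (s :* a) :* ((t :* b) :* d) := ((s :* t) :* (a :* b)) :* d) refl
      (sign j) (A zero j) (sign k) (A (suc zero) (punchIn j k)) (det (minor₂ A j k)))
  where open +-*-Solver

swap₀₁ : ∀ {n} → Fin (suc (suc n)) → Fin (suc (suc n))
swap₀₁ zero          = suc zero
swap₀₁ (suc zero)    = zero
swap₀₁ (suc (suc i)) = suc (suc i)

-- Expand both determinants along two rows and exchange the two columns in one of the double sums.
-- The product of the entries and the double minor are preserved, and only the sign changes.
det-swap₀₁ : ∀ {n} (A : Matrix (suc (suc n))) → det A ≡ ℚ.- det (A ∘ swap₀₁)
det-swap₀₁ A = begin
  det A
    ≡⟨ det-laplace₂ A ⟩
  sum (λ j → sum (laplaceTerm₂ A j))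
    ≡⟨ sum-cong-≗ (λ j → trans (sum-cong-≗ (exchange j)) (sum-neg (T′ j))) ⟩
  sum (λ j → ℚ.- sum (T′ j))
    ≡⟨ sum-neg (λ j → sum (T′ j)) ⟩
  ℚ.- sum (λ j → sum (T′ j))
    ≡⟨ cong ℚ.-_ (sum-exchange (laplaceTerm₂ B)) ⟩
  ℚ.- sum (λ j → sum (laplaceTerm₂ B j))
    ≡⟨ cong ℚ.-_ (det-laplace₂ B) ⟨
  ℚ.- det B
    ∎
  where
  open ≡-Reasoning
  open +-*-Solver
  B  = A ∘ swap₀₁
  T′ : ∀ j k → ℚ
  T′ j k = laplaceTerm₂ B (punchIn j k) (pinch k j)
  exchange : ∀ j k → laplaceTerm₂ A j k ≡ ℚ.- T′ j k
  exchange j k = begin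
    s ℚ.* (a ℚ.* b) ℚ.* d
      ≡⟨ solve 4 (λ s a b d → s :* (a :* b) :* d := :- ((:- s) :* (b :* a) :* d)) refl s a b d ⟩
    ℚ.- (ℚ.- s ℚ.* (b ℚ.* a) ℚ.* d)
      ≡⟨ cong (λ z → ℚ.- (z ℚ.* (b ℚ.* a) ℚ.* d)) (sign-exchange j k) ⟨
    ℚ.- (s′ ℚ.* (b ℚ.* a) ℚ.* d)
      ≡⟨ cong (λ i → ℚ.- (s′ ℚ.* (b ℚ.* A zero i) ℚ.* d)) (punchIn-pinch j k) ⟨
    ℚ.- (s′ ℚ.* (b ℚ.* A zero (punchIn (punchIn j k) (pinch k j))) ℚ.* d)
      ≡⟨ cong (λ z → ℚ.- (s′ ℚ.* (b ℚ.* A zero (punchIn (punchIn j k) (pinch k j))) ℚ.* z))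
           (det-cong λ i l → cong (A (suc (suc i))) (punchIn-punchIn-pinch j k l)) ⟨
    ℚ.- T′ j k
      ∎
    where
    s  = sign j ℚ.* sign k
    s′ = sign (punchIn j k) ℚ.* sign (pinch k j)
    a  = A zero j
    b  = A (suc zero) (punchIn j k)
    d  = det (minor₂ A j k)

-- Equal rows and first-row cofactors

p≡-p⇒p≡0 : ∀ {p} → p ≡ ℚ.- p → p ≡ 0ℚ
p≡-p⇒p≡0 {p} p≡-p = begin
  p                      ≡⟨ solve 1 (λ p → p := con ½ :* (p :+ p)) refl p ⟩
  ½ ℚ.* (p ℚ.+ p)        ≡⟨ cong (λ z → ½ ℚ.* (p ℚ.+ z)) p≡-p ⟩
  ½ ℚ.* (p ℚ.+ ℚ.- p)    ≡⟨ solve 1 (λ p → con ½ :* (p :+ :- p) := con 0ℚ) refl p ⟩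
  0ℚ                     ∎
  where
  open ≡-Reasoning
  open +-*-Solver

cofactor : ∀ {n} → Matrix (suc n) → Fin (suc n) → ℚ
cofactor A j = sign j ℚ.* det (minor A j)

det-cofactor : ∀ {n} (A : Matrix (suc n)) → det A ≡ sum λ j → A zero j ℚ.* cofactor A j
det-cofactor A = sum-cong-≗ λ j →
  solve 3 (λ s a d → (s :* a) :* d := a :* (s :* d)) refl (sign j) (A zero j) (det (minor A j))
  where open +-*-Solver

sum-zero : ∀ {n} {f : Vector ℚ n} → (∀ i → f i ≡ 0ℚ) → sum f ≡ 0ℚ
sum-zero {zero}  f≡0 = refl
sum-zero {suc n} f≡0 = cong₂ ℚ._+_ (f≡0 zero) (sum-zero (f≡0 ∘ suc))

-- If the first two rows are equal, swapping them shows that the determinant is its own negative.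
-- Otherwise the swap moves the first row to second place, where it heads every minor of the
-- expansion, and the minors vanish by induction.
det-equalRows : ∀ {n} (A : Matrix (suc n)) (i : Fin n) →
                (∀ j → A zero j ≡ A (suc i) j) → det A ≡ 0ℚ
det-equalRows A zero A₀≡A₁ =
  p≡-p⇒p≡0 (trans (det-swap₀₁ A) (cong ℚ.-_ (det-cong swap-invariant)))
  where
  swap-invariant : ∀ i j → A (swap₀₁ i) j ≡ A i j
  swap-invariant zero          j = sym (A₀≡A₁ j)
  swap-invariant (suc zero)    j = A₀≡A₁ j
  swap-invariant (suc (suc i)) j = refl
det-equalRows A (suc i) A₀≡Aᵢ = trans (det-swap₀₁ A) (cong ℚ.-_ det-swapped)
  where
  B = A ∘ swap₀₁
  det-swapped : det B ≡ 0ℚ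
  det-swapped = sum-zero λ j → trans
    (cong (sign j ℚ.* B zero j ℚ.*_) (det-equalRows (minor B j) i λ k → A₀≡Aᵢ (punchIn j k)))
    (ℚ.*-zeroʳ (sign j ℚ.* B zero j))

-- The cofactors do not involve the first row. The sum is thus the determinant of `A` with its first
-- row overwritten by row `suc i`, which has two equal rows.
row·cofactor≡0 : ∀ {n} (A : Matrix (suc n)) (i : Fin n) →
                 sum (λ j → A (suc i) j ℚ.* cofactor A j) ≡ 0ℚ
row·cofactor≡0 {n} A i = trans (sym (det-cofactor A′)) (det-equalRows A′ i λ _ → refl)
  where
  A′ : Matrix (suc n)
  A′ zero    = A (suc i)
  A′ (suc k) = A (suc k)

-- Diagonally dominant matrices

-- The entry vₘ exceeds the others by at least δ: |vₘ| ≥ Σ_{j ≠ m} |vⱼ| + δ.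
DominantEntry : ∀ {n} → ℚ → Vector ℚ n → Fin n → Set
DominantEntry δ v m = sum (λ j → ℚ.∣ v j ∣) ℚ.+ δ ℚ.≤ ℚ.∣ v m ∣ ℚ.+ ℚ.∣ v m ∣

DiagonallyDominant : ∀ {n} → ℚ → Matrix n → Set
DiagonallyDominant δ A = ∀ i → DominantEntry δ (A i) i

+-cancelʳ-≤ : ∀ r {p q} → p ℚ.+ r ℚ.≤ q ℚ.+ r → p ℚ.≤ q
+-cancelʳ-≤ r {p} {q} p+r≤q+r = begin
  p                    ≡⟨ cancel p r ⟩
  (p ℚ.+ r) ℚ.- r      ≤⟨ ℚ.+-monoˡ-≤ (ℚ.- r) p+r≤q+r ⟩
  (q ℚ.+ r) ℚ.- r      ≡⟨ cancel q r ⟨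
  q                    ∎
  where
  open ℚ.≤-Reasoning
  open +-*-Solver
  cancel : ∀ a b → a ≡ (a ℚ.+ b) ℚ.- b
  cancel = solve 2 (λ a b → a := (a :+ b) :- b) refl

-- As `c m` has the largest modulus, the `m`-th product exceeds the other products together by at
-- least `δ` times that modulus, so they cannot cancel it.
dominantEntry-sum : ∀ {n δ} (v : Vector ℚ n) m → DominantEntry δ v m →
                    ∀ (c : Vector ℚ n) → (∀ j → ℚ.∣ c j ∣ ℚ.≤ ℚ.∣ c m ∣) →
                    δ ℚ.* ℚ.∣ c m ∣ ℚ.≤ ℚ.∣ sum (λ j → v j ℚ.* c j) ∣
dominantEntry-sum {n} {δ} v m dom c c≤ = +-cancelʳ-≤ (V ℚ.* K) (begin
  δ ℚ.* K ℚ.+ V ℚ.* K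
    ≡⟨ solve 3 (λ d k v → d :* k :+ v :* k := (v :+ d) :* k) refl δ K V ⟩
  (V ℚ.+ δ) ℚ.* K
    ≤⟨ ℚ.*-monoʳ-≤-nonNeg K dom ⟩
  (ℚ.∣ v m ∣ ℚ.+ ℚ.∣ v m ∣) ℚ.* K
    ≡⟨ ℚ.*-distribʳ-+ K ℚ.∣ v m ∣ ℚ.∣ v m ∣ ⟩
  ℚ.∣ v m ∣ ℚ.* K ℚ.+ ℚ.∣ v m ∣ ℚ.* K
    ≡⟨ cong₂ ℚ._+_ (ℚ.∣p*q∣≡∣p∣*∣q∣ (v m) (c m)) (ℚ.∣p*q∣≡∣p∣*∣q∣ (v m) (c m)) ⟨
  ℚ.∣ w m ∣ ℚ.+ ℚ.∣ w m ∣
    ≤⟨ ∣summand∣≤ w m ⟩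
  ℚ.∣ sum w ∣ ℚ.+ sum (λ j → ℚ.∣ w j ∣)
    ≤⟨ ℚ.+-monoʳ-≤ ℚ.∣ sum w ∣ (sum-mono ∣w∣≤) ⟩
  ℚ.∣ sum w ∣ ℚ.+ sum (λ j → ℚ.∣ v j ∣ ℚ.* K)
    ≡⟨ cong (ℚ.∣ sum w ∣ ℚ.+_) (*-distribʳ-sum K (λ j → ℚ.∣ v j ∣)) ⟨
  ℚ.∣ sum w ∣ ℚ.+ V ℚ.* K
    ∎)
  where
  open ℚ.≤-Reasoning
  open +-*-Solver
  K = ℚ.∣ c m ∣
  V = sum (λ j → ℚ.∣ v j ∣)
  w : Vector ℚ n
  w j = v j ℚ.* c j
  instance
    K-nonNeg : ℚ.NonNegative K
    K-nonNeg = ℚ.nonNegative (ℚ.0≤∣p∣ (c m))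
  ∣w∣≤ : ∀ j → ℚ.∣ w j ∣ ℚ.≤ ℚ.∣ v j ∣ ℚ.* K
  ∣w∣≤ j = begin
    ℚ.∣ w j ∣                  ≡⟨ ℚ.∣p*q∣≡∣p∣*∣q∣ (v j) (c j) ⟩
    ℚ.∣ v j ∣ ℚ.* ℚ.∣ c j ∣
      ≤⟨ ℚ.*-monoˡ-≤-nonNeg ℚ.∣ v j ∣ {{ℚ.nonNegative (ℚ.0≤∣p∣ (v j))}} (c≤ j) ⟩
    ℚ.∣ v j ∣ ℚ.* K            ∎

module _ (δ : ℚ) {{δ-pos : ℚ.Positive δ}} where

  ∣cofactor∣≤ : ∀ {n} (A : Matrix (suc n)) → DiagonallyDominant δ A →
                ∀ j → ℚ.∣ cofactor A j ∣ ℚ.≤ ℚ.∣ cofactor A zero ∣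
  ∣cofactor∣≤ A dom with argmax (λ j → ℚ.∣ cofactor A j ∣)
  ... | zero  , c≤ = c≤
  -- Here the maximal modulus turns out to be zero, so all cofactors vanish and the bound at `zero`
  -- holds as well.
  ... | suc i , c≤ = λ j →
    ℚ.≤-trans (c≤ j) (ℚ.≤-trans cₘ≤0 (ℚ.0≤∣p∣ (cofactor A zero)))
    where
    open ℚ.≤-Reasoning
    cₘ≤0 : ℚ.∣ cofactor A (suc i) ∣ ℚ.≤ 0ℚ
    cₘ≤0 = ℚ.*-cancelˡ-≤-pos δ (begin
      δ ℚ.* ℚ.∣ cofactor A (suc i) ∣
        ≤⟨ dominantEntry-sum (A (suc i)) (suc i) (dom (suc i)) (cofactor A) c≤ ⟩
      ℚ.∣ sum (λ j → A (suc i) j ℚ.* cofactor A j) ∣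
        ≡⟨ cong ℚ.∣_∣ (row·cofactor≡0 A i) ⟩
      0ℚ
        ≡⟨ ℚ.*-zeroʳ δ ⟨
      δ ℚ.* 0ℚ ∎)

  -- The diagonal of this minor lies on that of `A`, so each row loses only an off-diagonal entry.
  minor-dominant : ∀ {n} {A : Matrix (suc n)} →
                   DiagonallyDominant δ A → DiagonallyDominant δ (minor A zero)
  minor-dominant {A = A} dom i = ℚ.≤-trans (ℚ.+-monoˡ-≤ δ drop) (dom (suc i))
    where
    open ℚ.≤-Reasoning
    s = sum (λ j → ℚ.∣ A (suc i) (suc j) ∣)
    drop : s ℚ.≤ ℚ.∣ A (suc i) zero ∣ ℚ.+ s
    drop = begin
      s                               ≡⟨ ℚ.+-identityˡ s ⟨
      0ℚ ℚ.+ s                        ≤⟨ ℚ.+-monoˡ-≤ s (ℚ.0≤∣p∣ (A (suc i) zero)) ⟩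
      ℚ.∣ A (suc i) zero ∣ ℚ.+ s      ∎

  dominant⇒^≤∣det∣ : ∀ {n} (A : Matrix n) → DiagonallyDominant δ A → δ ^ n ℚ.≤ ℚ.∣ det A ∣
  dominant⇒^≤∣det∣ {zero}  A dom = ℚ.≤-refl
  dominant⇒^≤∣det∣ {suc n} A dom = begin
    δ ℚ.* δ ^ n
      ≤⟨ ℚ.*-monoˡ-≤-nonNeg δ {{ℚ.pos⇒nonNeg δ}}
           (dominant⇒^≤∣det∣ (minor A zero) (minor-dominant {A = A} dom)) ⟩
    δ ℚ.* ℚ.∣ det (minor A zero) ∣
      -- `sign zero` computes to `1ℚ`.
      ≡⟨ cong (λ z → δ ℚ.* ℚ.∣ z ∣) (ℚ.*-identityˡ (det (minor A zero))) ⟨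
    δ ℚ.* ℚ.∣ cofactor A zero ∣
      ≤⟨ dominantEntry-sum (A zero) zero (dom zero) (cofactor A) (∣cofactor∣≤ A dom) ⟩
    ℚ.∣ sum (λ j → A zero j ℚ.* cofactor A j) ∣
      ≡⟨ cong ℚ.∣_∣ (det-cofactor A) ⟨
    ℚ.∣ det A ∣ ∎
    where open ℚ.≤-Reasoning

  ^-positive : ∀ n → 0ℚ ℚ.< δ ^ n
  ^-positive zero    = ℚ.positive⁻¹ 1ℚ
  ^-positive (suc n) = ℚ.positive⁻¹ (δ ℚ.* δ ^ n)
    {{ℚ.pos*pos⇒pos δ (δ ^ n) {{ℚ.positive (^-positive n)}}}}

-- Written so that its determinant is `charPoly A q` by definition.
charMatrix : ∀ {n} → Matrix n → ℚ → Matrix n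
charMatrix A q i j = q ℚ.* identity i j ℚ.+ ℚ.- A i j

identity-diag : ∀ {n} (i : Fin n) → identity i i ≡ 1ℚ
identity-diag i with i Fin.≟ i
... | yes _  = refl
... | no i≢i = contradiction refl i≢i

identity-off : ∀ {n} {i j : Fin n} → i ≢ j → identity i j ≡ 0ℚ
identity-off {i = i} {j} i≢j with i Fin.≟ j
... | yes i≡j = contradiction i≡j i≢j
... | no _    = refl

-- The row sum in the hypothesis includes `∣ A i i ∣`, which is the most that the diagonal entry can
-- lose against `∣ q ∣`; off the diagonal the moduli are those of `A`.
charMatrix-dominant : ∀ {n δ q} (A : Matrix n) →
                      (∀ i → sum (λ j → ℚ.∣ A i j ∣) ℚ.+ δ ℚ.≤ ℚ.∣ q ∣) →
                      DiagonallyDominant δ (charMatrix A q)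
charMatrix-dominant {n} {δ} {q} A rows i = +-cancelʳ-≤ a (begin
  (sum f ℚ.+ δ) ℚ.+ a
    ≡⟨ regroup (sum f) δ a ⟩
  (sum f ℚ.+ a) ℚ.+ δ
    ≤⟨ ℚ.+-monoˡ-≤ δ (sum-mono-except {f = f} {g} i off) ⟩
  (f i ℚ.+ sum g) ℚ.+ δ
    ≡⟨ ℚ.+-assoc (f i) (sum g) δ ⟩
  f i ℚ.+ (sum g ℚ.+ δ)
    ≤⟨ ℚ.+-monoʳ-≤ (f i) (rows i) ⟩
  f i ℚ.+ ℚ.∣ q ∣
    ≤⟨ ℚ.+-monoʳ-≤ (f i) diag ⟩
  f i ℚ.+ (f i ℚ.+ a)
    ≡⟨ ℚ.+-assoc (f i) (f i) a ⟨
  (f i ℚ.+ f i) ℚ.+ a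
    ∎)
  where
  open ℚ.≤-Reasoning
  open +-*-Solver
  f : Vector ℚ n
  f j = ℚ.∣ charMatrix A q i j ∣
  g : Vector ℚ n
  g j = ℚ.∣ A i j ∣
  a = g i
  regroup : ∀ x y z → (x ℚ.+ y) ℚ.+ z ≡ (x ℚ.+ z) ℚ.+ y
  regroup = solve 3 (λ x y z → (x :+ y) :+ z := (x :+ z) :+ y) refl
  off : ∀ j → i ≢ j → f j ℚ.≤ ℚ.∣ A i j ∣
  off j i≢j = ℚ.≤-reflexive (begin-equality
    ℚ.∣ q ℚ.* identity i j ℚ.+ ℚ.- A i j ∣
      ≡⟨ cong (λ z → ℚ.∣ q ℚ.* z ℚ.+ ℚ.- A i j ∣) (identity-off i≢j) ⟩
    ℚ.∣ q ℚ.* 0ℚ ℚ.+ ℚ.- A i j ∣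
      ≡⟨ cong ℚ.∣_∣ (solve 2 (λ q a → q :* con 0ℚ :+ :- a := :- a) refl q (A i j)) ⟩
    ℚ.∣ ℚ.- A i j ∣
      ≡⟨ ℚ.∣-p∣≡∣p∣ (A i j) ⟩
    ℚ.∣ A i j ∣ ∎)
  diag : ℚ.∣ q ∣ ℚ.≤ f i ℚ.+ a
  diag = begin
    ℚ.∣ q ∣
      ≡⟨ cong ℚ.∣_∣ (solve 2 (λ q a → q := (q :* con 1ℚ :+ :- a) :+ a) refl q (A i i)) ⟩
    ℚ.∣ (q ℚ.* 1ℚ ℚ.+ ℚ.- A i i) ℚ.+ A i i ∣
      ≡⟨ cong (λ z → ℚ.∣ (q ℚ.* z ℚ.+ ℚ.- A i i) ℚ.+ A i i ∣) (identity-diag i) ⟨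
    ℚ.∣ charMatrix A q i i ℚ.+ A i i ∣
      ≤⟨ ℚ.∣p+q∣≤∣p∣+∣q∣ (charMatrix A q i i) (A i i) ⟩
    f i ℚ.+ a ∎

-- Real eigenvalues

-- The homomorphism conditions are with respect to propositional equality: the
-- evaluation x ↦ seq x k satisfies them but does not respect _≃_.
module _ {a b ℓ₁ ℓ₂} (R : RawRing a ℓ₁) (S : RawRing b ℓ₂) where
  private
    module R = RawRing R
    module S = RawRing S
    module R′ = RawSemiringDefs R.rawSemiring
    module S′ = RawSemiringDefs S.rawSemiring
    module RDet = Determinant R
    module SDet = Determinant S

  module _ (h : R.Carrier → S.Carrier)
           (+-homo : ∀ x y → h (x R.+ y) ≡ h x S.+ h y)
           (*-homo : ∀ x y → h (x R.* y) ≡ h x S.* h y)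
           (-‿homo : ∀ x → h (R.- x) ≡ S.- h x)
           (0#-homo : h R.0# ≡ S.0#)
           (1#-homo : h R.1# ≡ S.1#) where

    -- The image is a separate vector `g`, known pointwise, which avoids function extensionality;
    -- `B` in `det-homo` has the same purpose.
    sum-homo : ∀ {n} (f : Vector R.Carrier n) {g : Vector S.Carrier n} →
               (∀ i → h (f i) ≡ g i) → h (R′.sum f) ≡ S′.sum g
    sum-homo {zero}  f h∘f≡g = 0#-homo
    sum-homo {suc n} f h∘f≡g =
      trans (+-homo (f zero) (R′.sum (f ∘ suc)))
            (cong₂ S._+_ (h∘f≡g zero) (sum-homo (f ∘ suc) (h∘f≡g ∘ suc)))

    sign-homo : ∀ m → h ((R.- R.1#) R′.^ m) ≡ (S.- S.1#) S′.^ m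
    sign-homo zero    = 1#-homo
    sign-homo (suc m) =
      trans (*-homo (R.- R.1#) ((R.- R.1#) R′.^ m))
            (cong₂ S._*_ (trans (-‿homo R.1#) (cong S.-_ 1#-homo)) (sign-homo m))

    det-homo : ∀ {n} (A : RDet.Matrix n) {B : SDet.Matrix n} →
               (∀ i j → h (A i j) ≡ B i j) → h (RDet.det A) ≡ SDet.det B
    det-homo {zero}  A h∘A≡B = 1#-homo
    det-homo {suc n} A h∘A≡B = sum-homo _ λ j →
      trans (*-homo _ _)
        (cong₂ S._*_
          (trans (*-homo _ _) (cong₂ S._*_ (sign-homo (toℕ j)) (h∘A≡B zero j)))
          (det-homo (RDet.minor A j) λ i k → h∘A≡B (suc i) (punchIn j k)))

    identity-homo : ∀ {n} (i j : Fin n) → h (RDet.identity i j) ≡ SDet.identity i j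
    identity-homo i j with does (i Fin.≟ j)
    ... | true  = 1#-homo
    ... | false = 0#-homo

    charPoly-homo : ∀ {n} (A : RDet.Matrix n) x →
                    h (RDet.charPoly A x) ≡ SDet.charPoly (λ i j → h (A i j)) (h x)
    charPoly-homo A x = det-homo _ λ i j →
      trans (+-homo _ _)
        (cong₂ S._+_ (trans (*-homo x _) (cong (h x S.*_) (identity-homo i j)))
                     (-‿homo (A i j)))

-- The operations on `ℝ` act termwise, so taking the `k`-th term is a homomorphism by computation.
seq-charPoly : ∀ {n} (A : ℝMatrix n) x k →
               seq (charPolyℝ A x) k ≡ charPoly (λ i j → seq (A i j) k) (seq x k)
seq-charPoly A x k =
  charPoly-homo ℝ-rawRing ℚ.+-*-rawRing (λ x → seq x k)
    (λ _ _ → refl) (λ _ _ → refl) (λ _ → refl) refl refl A x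

seq-product-zero : ∀ {n} (f : Vector ℝ n) i k → seq (f i) k ≡ 0ℚ → seq (productℝ f) k ≡ 0ℚ
seq-product-zero f zero    k fᵢ≡0 =
  trans (cong (ℚ._* seq (productℝ (f ∘ suc)) k) fᵢ≡0)
        (ℚ.*-zeroˡ (seq (productℝ (f ∘ suc)) k))
seq-product-zero f (suc i) k fᵢ≡0 =
  trans (cong (seq (f zero) k ℚ.*_) (seq-product-zero (f ∘ suc) i k fᵢ≡0))
        (ℚ.*-zeroʳ (seq (f zero) k))

-- The row sums are bounded at every index `k`, not just in the limit, since the dominance argument
-- runs at a single `k`.
∣eigenvalue∣≤rowSum : ∀ {n} {A : ℝMatrix n} {μ} → IsSpectrum A μ →
                      ∀ r → (∀ k i → sum (λ j → ℚ.∣ seq (A i j) k ∣) ℚ.≤ r) →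
                      ∀ i → ∣ μ i ∣ ≤ fromℚ r
∣eigenvalue∣≤rowSum {n} {A} {μ} spec r rows i ε ε>0 = N , λ k N≤k → ℚ.≰⇒> λ r+ε≤∣q∣ →
  ℚ.<-irrefl refl (ℚ.<-≤-trans (small k N≤k) (large k r+ε≤∣q∣))
  where
  instance
    ε-pos : ℚ.Positive ε
    ε-pos = ℚ.positive ε>0
  χ : ℕ → ℚ
  χ k = charPoly (λ i j → seq (A i j) k) (seq (μ i) k)
  -- The tolerance `ε ^ n` is the lower bound that dominance with margin `ε` gives for the
  -- determinant.
  vanishes = spec (μ i) (ε ^ n) (^-positive ε n)
  N = proj₁ vanishes
  small : ∀ k → N ℕ.≤ k → ℚ.∣ χ k ∣ ℚ.< ε ^ n
  small k N≤k = subst (ℚ._< ε ^ n) (cong ℚ.∣_∣ difference) (proj₂ vanishes k N≤k)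
    where
    open ≡-Reasoning
    difference : seq (charPolyℝ A (μ i)) k ℚ.- seq (productℝ λ j → μ i - μ j) k ≡ χ k
    difference = begin
      seq (charPolyℝ A (μ i)) k ℚ.- seq (productℝ λ j → μ i - μ j) k
        ≡⟨ cong₂ ℚ._-_ (seq-charPoly A (μ i) k)
             -- The factor `μ i - μ i` is exactly zero at each index, and so is the product.
             (seq-product-zero (λ j → μ i - μ j) i k (ℚ.+-inverseʳ (seq (μ i) k))) ⟩
      χ k ℚ.- 0ℚ
        ≡⟨ ℚ.+-identityʳ (χ k) ⟩
      χ k ∎
  large : ∀ k → r ℚ.+ ε ℚ.≤ ℚ.∣ seq (μ i) k ∣ → ε ^ n ℚ.≤ ℚ.∣ χ k ∣
  large k r+ε≤∣q∣ = dominant⇒^≤∣det∣ ε (charMatrix Aₖ (seq (μ i) k))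
    (charMatrix-dominant {q = seq (μ i) k} Aₖ
      λ i → ℚ.≤-trans (ℚ.+-monoˡ-≤ ε (rows k i)) r+ε≤∣q∣)
    where
    Aₖ : Matrix n
    Aₖ i j = seq (A i j) k

-- Order on the reals

halve : ∀ {ε} → 0ℚ ℚ.< ε → ∃ λ η → 0ℚ ℚ.< η × η ℚ.+ η ≡ ε
halve {ε} ε>0 = ε ℚ.* ½ ,
  ℚ.positive⁻¹ (ε ℚ.* ½) {{ℚ.pos*pos⇒pos ε {{ℚ.positive ε>0}} ½}} ,
  solve 1 (λ e → e :* con ½ :+ e :* con ½ := e) refl ε
  where open +-*-Solver

+-mono-≤ : ∀ {x y u v} → x ≤ y → u ≤ v → x + u ≤ y + v
+-mono-≤ {x} {y} {u} {v} x≤y u≤v ε ε>0 =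
  let η , η>0 , η+η≡ε = halve ε>0
      N , x<y         = x≤y η η>0
      L , u<v         = u≤v η η>0
  in N ℕ.⊔ L , λ k N⊔L≤k → begin-strict
    seq x k ℚ.+ seq u k
      <⟨ ℚ.+-mono-< (x<y k (ℕ.m⊔n≤o⇒m≤o N L N⊔L≤k)) (u<v k (ℕ.m⊔n≤o⇒n≤o N L N⊔L≤k)) ⟩
    (seq y k ℚ.+ η) ℚ.+ (seq v k ℚ.+ η)
      ≡⟨ regroup (seq y k) (seq v k) η ⟩
    (seq y k ℚ.+ seq v k) ℚ.+ (η ℚ.+ η)
      ≡⟨ cong (seq y k ℚ.+ seq v k ℚ.+_) η+η≡ε ⟩
    (seq y k ℚ.+ seq v k) ℚ.+ ε
      ∎
  where
  open ℚ.≤-Reasoning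
  open +-*-Solver
  regroup : ∀ a b e → (a ℚ.+ e) ℚ.+ (b ℚ.+ e) ≡ (a ℚ.+ b) ℚ.+ (e ℚ.+ e)
  regroup = solve 3 (λ a b e → (a :+ e) :+ (b :+ e) := (a :+ b) :+ (e :+ e)) refl

≤-refl : ∀ {x} → x ≤ x
≤-refl {x} ε ε>0 = 0 , λ k _ →
  subst (ℚ._< seq x k ℚ.+ ε) (ℚ.+-identityʳ (seq x k)) (ℚ.+-monoʳ-< (seq x k) ε>0)

≃-≤-trans : ∀ {x y z} → x ≃ y → y ≤ z → x ≤ z
≃-≤-trans {x} {y} {z} x≃y y≤z ε ε>0 =
  let η , η>0 , η+η≡ε = halve ε>0
      N , x∼y         = x≃y η η>0
      L , y<z         = y≤z η η>0
  in N ℕ.⊔ L , λ k N⊔L≤k → begin-strict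
    seq x k
      ≡⟨ solve 2 (λ a b → a := (a :- b) :+ b) refl (seq x k) (seq y k) ⟩
    (seq x k ℚ.- seq y k) ℚ.+ seq y k
      ≤⟨ ℚ.+-monoˡ-≤ (seq y k) (p≤∣p∣ (seq x k ℚ.- seq y k)) ⟩
    ℚ.∣ seq x k ℚ.- seq y k ∣ ℚ.+ seq y k
      <⟨ ℚ.+-mono-< (x∼y k (ℕ.m⊔n≤o⇒m≤o N L N⊔L≤k)) (y<z k (ℕ.m⊔n≤o⇒n≤o N L N⊔L≤k)) ⟩
    η ℚ.+ (seq z k ℚ.+ η)
      ≡⟨ solve 2 (λ e c → e :+ (c :+ e) := c :+ (e :+ e)) refl η (seq z k) ⟩
    seq z k ℚ.+ (η ℚ.+ η)
      ≡⟨ cong (seq z k ℚ.+_) η+η≡ε ⟩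
    seq z k ℚ.+ ε
      ∎
  where
  open ℚ.≤-Reasoning
  open +-*-Solver
  p≤∣p∣ : ∀ p → p ℚ.≤ ℚ.∣ p ∣
  p≤∣p∣ p with ℚ.≤-total 0ℚ p
  ... | inj₁ 0≤p = ℚ.≤-reflexive (sym (ℚ.0≤p⇒∣p∣≡p 0≤p))
  ... | inj₂ p≤0 = ℚ.≤-trans p≤0 (ℚ.0≤∣p∣ p)

-- Natural numbers as rationals, and constant bounds on sums

ℕ→ℚ : ℕ → ℚ
ℕ→ℚ n = ℤ.+ n ℚ./ 1

-- The division in `ℕ→ℚ` normalises by a gcd that does not reduce for a variable `n`; passing to
-- unnormalised fractions removes it.
toℚᵘ-ℕ→ℚ : ∀ n → ℚ.toℚᵘ (ℕ→ℚ n) ℚᵘ.≃ ℚᵘ.mkℚᵘ (ℤ.+ n) 0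
toℚᵘ-ℕ→ℚ n = ℚ.toℚᵘ-fromℚᵘ (ℚᵘ.mkℚᵘ (ℤ.+ n) 0)

ℕ→ℚ-homo-+ : ∀ m n → ℕ→ℚ (m ℕ.+ n) ≡ ℕ→ℚ m ℚ.+ ℕ→ℚ n
ℕ→ℚ-homo-+ m n = ℚ.toℚᵘ-injective (begin
  ℚ.toℚᵘ (ℕ→ℚ (m ℕ.+ n))                         ≈⟨ toℚᵘ-ℕ→ℚ (m ℕ.+ n) ⟩
  ℚᵘ.mkℚᵘ (ℤ.+ (m ℕ.+ n)) 0                      ≈⟨ ℚᵘ.*≡* (cong (ℤ._* ℤ.1ℤ) numerators) ⟩
  ℚᵘ.mkℚᵘ (ℤ.+ m) 0 ℚᵘ.+ ℚᵘ.mkℚᵘ (ℤ.+ n) 0       ≈⟨ ℚᵘ.+-cong (toℚᵘ-ℕ→ℚ m) (toℚᵘ-ℕ→ℚ n) ⟨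
  ℚ.toℚᵘ (ℕ→ℚ m) ℚᵘ.+ ℚ.toℚᵘ (ℕ→ℚ n)             ≈⟨ ℚ.toℚᵘ-homo-+ (ℕ→ℚ m) (ℕ→ℚ n) ⟨
  ℚ.toℚᵘ (ℕ→ℚ m ℚ.+ ℕ→ℚ n)                       ∎)
  where
  open import Relation.Binary.Reasoning.Setoid ℚᵘ.≃-setoid
  numerators : ℤ.+ (m ℕ.+ n) ≡ ℤ.+ m ℤ.* ℤ.1ℤ ℤ.+ ℤ.+ n ℤ.* ℤ.1ℤ
  numerators = sym (cong₂ ℤ._+_ (ℤ.*-identityʳ (ℤ.+ m)) (ℤ.*-identityʳ (ℤ.+ n)))

ℕ→ℚ-mono-≤ : ∀ {m n} → m ℕ.≤ n → ℕ→ℚ m ℚ.≤ ℕ→ℚ n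
ℕ→ℚ-mono-≤ {m} {n} m≤n = ℚ.toℚᵘ-cancel-≤ (begin
  ℚ.toℚᵘ (ℕ→ℚ m)       ≃⟨ toℚᵘ-ℕ→ℚ m ⟩
  ℚᵘ.mkℚᵘ (ℤ.+ m) 0    ≤⟨ ℚᵘ.*≤* (ℤ.*-monoʳ-≤-nonNeg ℤ.1ℤ (ℤ.+≤+ m≤n)) ⟩
  ℚᵘ.mkℚᵘ (ℤ.+ n) 0    ≃⟨ toℚᵘ-ℕ→ℚ n ⟨
  ℚ.toℚᵘ (ℕ→ℚ n)       ∎)
  where open ℚᵘ.≤-Reasoning

sum-ℕ→ℚ : ∀ n m → sum {n} (λ _ → ℕ→ℚ m) ≡ ℕ→ℚ (n ℕ.* m)
sum-ℕ→ℚ zero    m = refl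
sum-ℕ→ℚ (suc n) m = trans (cong (ℕ→ℚ m ℚ.+_) (sum-ℕ→ℚ n m)) (sym (ℕ→ℚ-homo-+ m (n ℕ.* m)))

sumℝ-bounded : ∀ {n r} {f : Vector ℝ n} → (∀ i → f i ≤ fromℚ r) →
               sumℝ f ≤ fromℚ (sum {n} (λ _ → r))
sumℝ-bounded {zero}      f≤r = ≤-refl {0ℝ}
sumℝ-bounded {suc n} {r} {f} f≤r =
  +-mono-≤ {f zero} {fromℚ r} {sumℝ (f ∘ suc)} {fromℚ (sum {n} λ _ → r)}
    (f≤r zero) (sumℝ-bounded (f≤r ∘ suc))

-- Disjoint paths and degrees

-- Pigeonhole: sending each position in `xs` to a position of the same element in `ys` is injective.
unique-⊆⇒length≤ : ∀ {A : Set} {xs ys : List A} → Unique xs → xs ⊆ ys → length xs ℕ.≤ length ys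
unique-⊆⇒length≤ {xs = xs} {ys} unique xs⊆ys = Fin.injective⇒≤ {f = position} λ {i} {j} eq →
  lookup-injective unique (begin
    lookup xs i             ≡⟨ lookup-index (xs⊆ys (∈-lookup i)) ⟩
    lookup ys (position i)  ≡⟨ cong (lookup ys) eq ⟩
    lookup ys (position j)  ≡⟨ lookup-index (xs⊆ys (∈-lookup j)) ⟨
    lookup xs j             ∎)
  where
  open ≡-Reasoning
  position : Fin (length xs) → Fin (length ys)
  position i = index (xs⊆ys (∈-lookup {xs = xs} i))

-- The decision is a variable here, so that matching on it makes the `if` reduce.
seq-if-zero : ∀ {P : Set} (P? : Dec P) m k → P →
              seq (if does P? then 0ℝ else fromℕ m) k ≡ 0ℚ
seq-if-zero (yes _) m k x = refl
seq-if-zero (no ¬x) m k x = contradiction x ¬x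

∣seq-if∣≤ : ∀ b m k {n} → m ℕ.≤ n →
            ℚ.∣ seq (if b then 0ℝ else fromℕ m) k ∣ ℚ.≤ ℕ→ℚ n
∣seq-if∣≤ true  m k {n} m≤n = ℕ→ℚ-mono-≤ {0} {n} ℕ.z≤n
∣seq-if∣≤ false m k {n} m≤n =
  ℚ.≤-trans (ℚ.≤-reflexive (ℚ.0≤p⇒∣p∣≡p (ℕ→ℚ-mono-≤ {0} {m} ℕ.z≤n))) (ℕ→ℚ-mono-≤ {m} {n} m≤n)

module _ {p : ℕ} (M : Graph p) where
  open Graph M

  secondVertex-adjacent : ∀ {u v ws} → IsPath M u v ws → Adj u (secondVertex M u v ws)
  secondVertex-adjacent {ws = []}    (mkIsPath _ (u∼v ∷ _)) = u∼v
  secondVertex-adjacent {ws = _ ∷ _} (mkIsPath _ (u∼w ∷ _)) = u∼w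

  disjointPaths-length≤degree : ∀ {u v wss} → VertexDisjointPaths M u v wss →
                                length wss ℕ.≤ degree M u
  disjointPaths-length≤degree {u} {v} {wss} vd =
    subst (ℕ._≤ degree M u) (List.length-map (secondVertex M u v) wss)
          (unique-⊆⇒length≤ (secondVertex-unique M u v vd) λ x∈ → neighbour (∈-map⁻ _ x∈))
    where
    neighbour : ∀ {x} → (∃ λ ws → ws ∈ wss × x ≡ secondVertex M u v ws) →
                x ∈ filter (adj? u) (allFin p)
    neighbour (ws , ws∈ , refl) = ∈-filter⁺ (adj? u) (∈-allFin _)
      (secondVertex-adjacent (All.lookup (VertexDisjointPaths.paths vd) ws∈))

  degree≤maxDegree : ∀ v → degree M v ℕ.≤ maxDegree M
  degree≤maxDegree v =
    All.lookup (xs≤max 0 (map (degree M) (allFin p))) (∈-map⁺ (degree M) (∈-allFin v))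

  -- Stated for any `k` meeting the specification, so that the argument is about an attaining family
  -- and not about the exhaustive search.
  isMaxDisjointPaths⇒≤maxDegree : ∀ {u v k} → IsMaxDisjointPaths M u v k → k ℕ.≤ maxDegree M
  isMaxDisjointPaths⇒≤maxDegree {u} (mkIsMaxDisjointPaths (_ , refl , vd) _) =
    ℕ.≤-trans (disjointPaths-length≤degree vd) (degree≤maxDegree u)

  maxDisjointPaths≤maxDegree : ∀ u v → maxDisjointPaths M u v ℕ.≤ maxDegree M
  maxDisjointPaths≤maxDegree u v = isMaxDisjointPaths⇒≤maxDegree (proj₂ (∃maxDisjointPaths M u v))

  pathMatrix-diag : ∀ i k → seq (pathMatrix M i i) k ≡ 0ℚ
  pathMatrix-diag i k = seq-if-zero (i Fin.≟ i) (maxDisjointPaths M i i) k refl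

  ∣pathMatrix∣≤maxDegree : ∀ i j k → ℚ.∣ seq (pathMatrix M i j) k ∣ ℚ.≤ ℕ→ℚ (maxDegree M)
  ∣pathMatrix∣≤maxDegree i j k =
    ∣seq-if∣≤ (does (i Fin.≟ j)) (maxDisjointPaths M i j) k (maxDisjointPaths≤maxDegree i j)

-- Comparing with the constant `Δ` off the diagonal, where the entry is zero on it, saves one of the
-- `p` copies of `Δ`.
pathMatrix-rowSum : ∀ {p} (M : Graph p) k i →
  sum (λ j → ℚ.∣ seq (pathMatrix M i j) k ∣) ℚ.≤ ℕ→ℚ ((p ∸ 1) *ℕ maxDegree M)
-- For `p` equal to 0 there is no row `i`, so `p ∸ 1` is a true predecessor.
pathMatrix-rowSum {suc n} M k i = +-cancelʳ-≤ Δ (begin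
  sum f ℚ.+ Δ
    ≤⟨ sum-mono-except {f = f} {λ _ → Δ} i (λ j _ → ∣pathMatrix∣≤maxDegree M i j k) ⟩
  f i ℚ.+ sum {suc n} (λ _ → Δ)
    ≡⟨ cong (λ z → ℚ.∣ z ∣ ℚ.+ sum {suc n} (λ _ → Δ)) (pathMatrix-diag M i k) ⟩
  0ℚ ℚ.+ (Δ ℚ.+ sum {n} (λ _ → Δ))
    ≡⟨ solve 2 (λ d s → con 0ℚ :+ (d :+ s) := s :+ d) refl Δ (sum {n} (λ _ → Δ)) ⟩
  sum {n} (λ _ → Δ) ℚ.+ Δ
    ≡⟨ cong (ℚ._+ Δ) (sum-ℕ→ℚ n (maxDegree M)) ⟩
  ℕ→ℚ (n *ℕ maxDegree M) ℚ.+ Δ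
    ∎)
  where
  open ℚ.≤-Reasoning
  open +-*-Solver
  Δ = ℕ→ℚ (maxDegree M)
  f : Vector ℚ (suc n)
  f j = ℚ.∣ seq (pathMatrix M i j) k ∣

corollary2p4 : (p : ℕ) (M : Graph p) (PE : ℝ) → IsPathEnergy M PE →
    PE ≤ fromℕ (p *ℕ (p ∸ 1) *ℕ maxDegree M)
corollary2p4 p M PE (μ , spec , PE≃) =
  -- All `p` eigenvalues obey the same bound `r`, so their moduli sum to at most `p` copies of it.
  ≃-≤-trans {PE} {sumℝ (λ i → ∣ μ i ∣)} {fromℕ (p *ℕ (p ∸ 1) *ℕ maxDegree M)} PE≃
    (subst (λ z → sumℝ (λ i → ∣ μ i ∣) ≤ fromℚ z) bound
      (sumℝ-bounded {f = λ i → ∣ μ i ∣}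
        (∣eigenvalue∣≤rowSum {A = pathMatrix M} {μ} spec r (pathMatrix-rowSum M))))
  where
  r = ℕ→ℚ ((p ∸ 1) *ℕ maxDegree M)
  bound : sum {p} (λ _ → r) ≡ ℕ→ℚ (p *ℕ (p ∸ 1) *ℕ maxDegree M)
  bound = trans (sum-ℕ→ℚ p ((p ∸ 1) *ℕ maxDegree M))
                (cong ℕ→ℚ (sym (ℕ.*-assoc p (p ∸ 1) (maxDegree M))))
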